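{- There is a constant $c$ such that for every Boolean circuit $C$ with input nodes $\mathrm{in}_1,\dots,\mathrm{in}_n$ whose gates are only $\neg$-gates, $\vee$-gates and $\wedge$-gates, there exists an instruction sequence $X\in\mathrm{IS}_{br}$ in which the basic instruction $\mathrm{out}.\mathrm{set}{:}F$ does not occur (in any plain, positive test or negative test instruction) such that $X$ computes the $n$-ary Boolean function induced by $C$ and $|X|\le c\cdot(\mathrm{size}(C)+1)$.
   Context: $\mathbb B=\{T,F\}$. A Boolean circuit with input nodes $\mathrm{in}_1,\dots,\mathrm{in}_n$ is a finite directed acyclic graph whose non-input nodes (gates) are $\neg$-gates with one predecessor or $\vee$-/$\wedge$-gates with two predecessors, with one designated output node; the induced function $\mathbb B^n\to\mathbb B$ is the value of the output node when $\mathrm{in}_j$ carries $b_j$. Its size is its number of nodes. A primitive instruction is one of: a plain basic instruction $a$, a positive test instruction $+a$, a negative test instruction $-a$ (for a basic instruction $a$), a forward jump instruction $\#l$ ($l\in\mathbb N$), or the termination instruction $!$. An instruction sequence is a finite nonempty sequence $X=u_1;\dots;u_k$ of primitive instructions; its length is $|X|=k$. Basic instructions have the form $f.m$ where the focus $f$ is one of $\mathrm{in}{:}i$, $\mathrm{aux}{:}i$ ($i\ge 1$) or $\mathrm{out}$, each naming a Boolean register, and the method $m$ is one of $\mathrm{set}{:}T$, $\mathrm{set}{:}F$, $\mathrm{get}$. Executing $f.\mathrm{set}{:}b$ sets register $f$ to $b$ and yields reply $b$; executing $f.\mathrm{get}$ leaves the register unchanged and yields its content as reply. Execution of $X=u_1;\dots;u_k$: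 a counter starts at $1$. If the counter exceeds $k$, execution deadlocks. At position $i$: if $u_i=!$, execution terminates; if $u_i=\#l$, execution deadlocks if $l=0$ and otherwise the counter becomes $i+l$; if $u_i$ is $a$, $+a$ or $-a$, the basic instruction $a$ is executed yielding reply $r$, and the counter becomes $i+1$ for $u_i=a$; for $u_i=+a$ it becomes $i+1$ if $r=T$ and $i+2$ if $r=F$; for $u_i=-a$ it becomes $i+1$ if $r=F$ and $i+2$ if $r=T$. $\mathrm{IS}_{br}$ is the set of instruction sequences in which every basic instruction occurring belongs to $\{f.\mathrm{get}: f=\mathrm{in}{:}i \text{ or } f=\mathrm{aux}{:}i\}\cup\{f.\mathrm{set}{:}b: f=\mathrm{aux}{:}i \text{ or } f=\mathrm{out},\ b\in\mathbb B\}$. $X\in\mathrm{IS}_{br}$ computes $f:\mathbb B^n\to\mathbb B$ if for every $(b_1,\dots,b_n)\in\mathbb B^n$: when $X$ is executed with register $\mathrm{in}{:}j$ initialised to $b_j$ ($j\le n$) and all registers $\mathrm{aux}{:}i$ and $\mathrm{out}$ initialised to $F$, execution terminates (does not deadlock) without ever executing a basic instruction with focus $\mathrm{in}{:}j$ for $j>n$, and at termination register $\mathrm{out}$ contains $f(b_1,\dots,b_n)$. -}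

module Defs where

open import Data.Bool using (Bool; true; false; not; _∧_; _∨_; if_then_else_)
open import Data.Fin using (Fin; toℕ)
open import Data.Fin.Induction using (spo-wellFounded)
open import Data.List using (List; []; _∷_; head; drop)
open import Data.List.NonEmpty using (List⁺; toList)
open import Data.List.Relation.Unary.All using (All)
open import Data.List.Relation.Unary.Any using (Any)
open import Data.Maybe using (Maybe; just)
open import Data.Nat using (ℕ; _+_; _<_)
import Data.Nat.Properties as ℕ
open import Data.Product using (_×_; _,_; ∃-syntax)
open import Data.Sum using (_⊎_; inj₁; inj₂)
open import Data.Unit using (⊤)
open import Data.Vec using (Vec; lookup)
open import Induction.WellFounded using (Acc; acc; WellFounded)
open import Relation.Binary.Construct.Closure.Transitive
  using (TransClosure; [_]; _++_)
open import Relation.Binary.Definitions using (DecidableEquality)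
open import Relation.Binary.PropositionalEquality
  using (_≡_; _≢_; refl; isEquivalence; resp₂)
open import Relation.Nullary using (¬_; yes; no; does)

------------------------------------------------------------------------
-- Boolean circuits

data Gate (A : Set) : Set where
  ¬-gate : A → Gate A
  ∨-gate : A → A → Gate A
  ∧-gate : A → A → Gate A

data _∈preds_ {A : Set} : A → Gate A → Set where
  ¬-pred  : ∀ {p}   → p ∈preds ¬-gate p
  ∨-predˡ : ∀ {p q} → p ∈preds ∨-gate p q
  ∨-predʳ : ∀ {p q} → q ∈preds ∨-gate p q
  ∧-predˡ : ∀ {p q} → p ∈preds ∧-gate p q
  ∧-predʳ : ∀ {p q} → q ∈preds ∧-gate p q

-- The j-th input node is inj₁ j.
Node : ℕ → ℕ → Set
Node n g = Fin n ⊎ Fin g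

data Edge {n g : ℕ} (gate : Fin g → Gate (Node n g)) :
          Node n g → Node n g → Set where
  edge : ∀ {p k} → p ∈preds gate k → Edge gate p (inj₂ k)

record Circuit (n : ℕ) : Set where
  field
    gates   : ℕ
    gate    : Fin gates → Gate (Node n gates)
    acyclic : ∀ v → ¬ TransClosure (Edge gate) v v
    output  : Node n gates

size : ∀ {n} → Circuit n → ℕ
size {n} C = n + Circuit.gates C

-- A finite acyclic graph is well-founded, so values can be computed by
-- recursion along edges.
module _ {n : ℕ} (C : Circuit n) where
  open Circuit C

  private
    _⊏_ : Fin gates → Fin gates → Set
    k ⊏ l = TransClosure (Edge gate) (inj₂ k) (inj₂ l)

    ⊏-wellFounded : WellFounded _⊏_
    ⊏-wellFounded = spo-wellFounded record
      { isEquivalence = isEquivalence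
      ; irrefl        = λ { {k} refl → acyclic (inj₂ k) }
      ; trans         = _++_
      ; <-resp-≈      = resp₂ _⊏_
      }

    gate-acc : ∀ {k} → Acc _⊏_ k → Acc (Edge gate) (inj₂ k)
    gate-acc (acc rs) = acc λ
      { {inj₁ _} _ → acc λ ()
      ; {inj₂ l} e → gate-acc (rs [ e ])
      }

  edge-wellFounded : WellFounded (Edge gate)
  edge-wellFounded (inj₁ _) = acc λ ()
  edge-wellFounded (inj₂ k) = gate-acc (⊏-wellFounded k)

gateValue : {A : Set} (G : Gate A) → (∀ p → p ∈preds G → Bool) → Bool
gateValue (¬-gate p)   val = not (val p ¬-pred)
gateValue (∨-gate p q) val = val p ∨-predˡ ∨ val q ∨-predʳ
gateValue (∧-gate p q) val = val p ∧-predˡ ∧ val q ∧-predʳ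

valueAcc : ∀ {n g} (gate : Fin g → Gate (Node n g)) → Vec Bool n →
           (v : Node n g) → Acc (Edge gate) v → Bool
valueAcc gate b (inj₁ j) _        = lookup b j
valueAcc gate b (inj₂ k) (acc rs) =
  gateValue (gate k) λ p p∈ → valueAcc gate b p (rs (edge p∈))

value : ∀ {n} (C : Circuit n) → Vec Bool n → Node n (Circuit.gates C) → Bool
value C b v = valueAcc (Circuit.gate C) b v (edge-wellFounded C v)

induced : ∀ {n} → Circuit n → Vec Bool n → Bool
induced C b = value C b (Circuit.output C)

------------------------------------------------------------------------
-- Instruction sequences

-- Indices start at 0: inp i and aux i are the registers in:(i+1) and
-- aux:(i+1).
data Focus : Set where
  inp : ℕ → Focus
  aux : ℕ → Focus
  out : Focus

data Method : Set where
  set : Bool → Method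
  get : Method

infix 8 _∙_

record Basic : Set where
  constructor _∙_
  field
    focus  : Focus
    method : Method

data Instr : Set where
  plain  : Basic → Instr
  +test  : Basic → Instr
  -test  : Basic → Instr
  #_     : ℕ → Instr
  !      : Instr

InstrSeq : Set
InstrSeq = List⁺ Instr

data _OccursIn₁_ (a : Basic) : Instr → Set where
  in-plain : a OccursIn₁ plain a
  in-+test : a OccursIn₁ +test a
  in--test : a OccursIn₁ -test a

_OccursIn_ : Basic → InstrSeq → Set
a OccursIn X = Any (a OccursIn₁_) (toList X)

data Permitted : Basic → Set where
  get-inp : ∀ {i}   → Permitted (inp i ∙ get)
  get-aux : ∀ {i}   → Permitted (aux i ∙ get)
  set-aux : ∀ {i b} → Permitted (aux i ∙ set b)
  set-out : ∀ {b}   → Permitted (out ∙ set b)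

ISbr : InstrSeq → Set
ISbr X = ∀ a → a OccursIn X → Permitted a

------------------------------------------------------------------------
-- Execution

_≟_ : DecidableEquality Focus
inp i ≟ inp j with i ℕ.≟ j
... | yes refl = yes refl
... | no  i≢j  = no λ { refl → i≢j refl }
aux i ≟ aux j with i ℕ.≟ j
... | yes refl = yes refl
... | no  i≢j  = no λ { refl → i≢j refl }
out   ≟ out   = yes refl
inp _ ≟ aux _ = no λ ()
inp _ ≟ out   = no λ ()
aux _ ≟ inp _ = no λ ()
aux _ ≟ out   = no λ ()
out   ≟ inp _ = no λ ()
out   ≟ aux _ = no λ ()

State : Set
State = Focus → Bool

reply : Basic → State → Bool
reply (f ∙ set b) σ = b
reply (f ∙ get)   σ = σ f

effect : Basic → State → State
effect (f ∙ set b) σ f′ = if does (f′ ≟ f) then b else σ f′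
effect (f ∙ get)   σ    = σ

-- The instruction at a position, counted from 0.
fetch : InstrSeq → ℕ → Maybe Instr
fetch X i = head (drop i (toList X))

-- Run X i σ t τ : execution of X from counter i and state σ terminates in
-- state τ, and t lists the basic instructions executed.  The two forms of
-- deadlock (#0 and a counter beyond the end) have no rule.
data Run (X : InstrSeq) : ℕ → State → List Basic → State → Set where
  run-!     : ∀ {i σ} → fetch X i ≡ just ! → Run X i σ [] σ
  run-#     : ∀ {i l σ t τ} → fetch X i ≡ just (# l) → l ≢ 0 →
              Run X (i + l) σ t τ → Run X i σ t τ
  run-plain : ∀ {i a σ t τ} → fetch X i ≡ just (plain a) →
              Run X (1 + i) (effect a σ) t τ → Run X i σ (a ∷ t) τ
  run-+test : ∀ {i a σ t τ} → fetch X i ≡ just (+test a) →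
              Run X (if reply a σ then 1 + i else 2 + i) (effect a σ) t τ →
              Run X i σ (a ∷ t) τ
  run--test : ∀ {i a σ t τ} → fetch X i ≡ just (-test a) →
              Run X (if reply a σ then 2 + i else 1 + i) (effect a σ) t τ →
              Run X i σ (a ∷ t) τ

-- The registers in:j with j > n are left unconstrained.
record Initial {n : ℕ} (b : Vec Bool n) (σ : State) : Set where
  field
    inp-init : ∀ (j : Fin n) → σ (inp (toℕ j)) ≡ lookup b j
    aux-init : ∀ i → σ (aux i) ≡ false
    out-init : σ out ≡ false

-- With indices starting at 0, in:j with j ≤ n is inp i with i < n.
InputWithin : ℕ → Basic → Set
InputWithin n (inp i ∙ _) = i < n
InputWithin n (aux _ ∙ _) = ⊤
InputWithin n (out   ∙ _) = ⊤

Computes : ∀ {n} → InstrSeq → (Vec Bool n → Bool) → Set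
Computes {n} X f = ∀ (b : Vec Bool n) (σ : State) → Initial b σ →
  ∃[ t ] ∃[ τ ] Run X 0 σ t τ × All (InputWithin n) t × τ out ≡ f b

{-# OPTIONS --safe #-}
-- A depth-first search from the output node lists gates in topological order
-- without repetitions.  Gate k gets the auxiliary register k, which starts as F:
-- a few test instructions decide whether the gate has value T, and if so execute
-- a single aux.set:T, so nothing ever has to be reset.  The output node is copied
-- into out in the same way.
module Submission where

open import Defs
open import Data.Bool using (Bool; true; false; not; _∧_; _∨_; if_then_else_)
open import Data.Empty using (⊥-elim)
open import Data.Fin using (Fin; toℕ)
import Data.Fin as Fin
import Data.Fin.Properties as Fin
open import Data.List using (List; []; _∷_; _++_; drop; head)
import Data.List as List
open import Data.List.Membership.Propositional using (_∈_; _∉_)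
open import Data.List.Membership.DecPropositional using (_∈?_)
open import Data.List.Membership.Propositional.Properties using (∈-lookup)
open import Data.List.NonEmpty using (length; toList; _∷_)
open import Data.List.Properties using (drop-drop; length-++)
open import Data.List.Relation.Binary.Subset.Propositional using (_⊆_)
open import Data.List.Relation.Unary.All as All using (All; []; _∷_; lookupAny)
open import Data.List.Relation.Unary.All.Properties using (++⁺; ¬Any⇒All¬)
open import Data.List.Relation.Unary.AllPairs using ([]; _∷_)
open import Data.List.Relation.Unary.Any using (here; there)
open import Data.List.Relation.Unary.Unique.Propositional using (Unique)
open import Data.Nat using (ℕ; suc; _+_; _*_; _≤_; z≤n)
open import Data.Nat.Properties
  using (≤-refl; +-assoc; +-comm; *-suc; +-monoˡ-≤; +-monoʳ-≤; *-monoʳ-≤; m≤n+m; module ≤-Reasoning)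
open import Data.Product using (_×_; _,_; proj₁; proj₂; ∃-syntax)
open import Data.Sum using (inj₁; inj₂)
open import Data.Unit using (⊤; tt)
open import Data.Vec using (Vec; lookup)
open import Function using (_∘_; id)
open import Induction.WellFounded using (Acc; acc)
open import Relation.Binary.PropositionalEquality
  using (_≡_; _≢_; refl; sym; trans; cong; cong₂; subst)
open import Relation.Nullary using (¬_; yes; no)
open import Relation.Nullary.Decidable using (dec-true; dec-false)

-- Values of circuit nodes.

gateValue-cong : ∀ {A : Set} (G : Gate A) {v w : ∀ p → p ∈preds G → Bool} →
  (∀ p (p∈ : p ∈preds G) → v p p∈ ≡ w p p∈) → gateValue G v ≡ gateValue G w
gateValue-cong (¬-gate p)   eq = cong not (eq p ¬-pred)
gateValue-cong (∨-gate p q) eq = cong₂ _∨_ (eq p ∨-predˡ) (eq q ∨-predʳ)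
gateValue-cong (∧-gate p q) eq = cong₂ _∧_ (eq p ∧-predˡ) (eq q ∧-predʳ)

-- Simultaneous recursion on both accessibility proofs compares only the resulting Booleans, so no
-- equality between the proofs, and no function extensionality, is involved.
valueAcc-irrelevant : ∀ {n g} (gate : Fin g → Gate (Node n g)) (b : Vec Bool n) v
  (a a′ : Acc (Edge gate) v) → valueAcc gate b v a ≡ valueAcc gate b v a′
valueAcc-irrelevant gate b (inj₁ j) _        _         = refl
valueAcc-irrelevant gate b (inj₂ k) (acc rs) (acc rs′) =
  gateValue-cong (gate k) λ p p∈ →
    valueAcc-irrelevant gate b p (rs (edge p∈)) (rs′ (edge p∈))

-- Recursion below gate `k` uses the accessibility proofs stored inside that of `k`; irrelevance
-- exchanges them for the ones `value` chooses.
value-gate : ∀ {n} (C : Circuit n) (b : Vec Bool n) k →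
  value C b (inj₂ k) ≡ gateValue (Circuit.gate C k) (λ p _ → value C b p)
value-gate C b k with edge-wellFounded C (inj₂ k)
... | acc rs = gateValue-cong (Circuit.gate C k) λ p p∈ →
  valueAcc-irrelevant (Circuit.gate C) b p (rs (edge p∈)) (edge-wellFounded C p)

-- Pigeonhole bound for lists without repetitions.

lookup-injective : ∀ {A : Set} {xs : List A} → Unique xs → ∀ i j →
  List.lookup xs i ≡ List.lookup xs j → i ≡ j
lookup-injective (_  ∷ _)   Fin.zero    Fin.zero    _  = refl
lookup-injective (x∉ ∷ _)   Fin.zero    (Fin.suc j) eq = ⊥-elim (All.lookup x∉ (∈-lookup j) eq)
lookup-injective (x∉ ∷ _)   (Fin.suc i) Fin.zero    eq = ⊥-elim (All.lookup x∉ (∈-lookup i) (sym eq))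
lookup-injective (_  ∷ xs!) (Fin.suc i) (Fin.suc j) eq = cong Fin.suc (lookup-injective xs! i j eq)

Unique⇒length≤ : ∀ {g} {D : List (Fin g)} → Unique D → List.length D ≤ g
Unique⇒length≤ D! = Fin.injective⇒≤ (λ {i} {j} → lookup-injective D! i j)

-- Topological ordering by depth-first search.

module _ {n g : ℕ} (gate : Fin g → Gate (Node n g)) where

  Ready : List (Fin g) → Node n g → Set
  Ready D (inj₁ _) = ⊤
  Ready D (inj₂ k) = k ∈ D

  -- The gate evaluated last comes first.
  data Schedule : List (Fin g) → Set where
    []  : Schedule []
    add : ∀ {k D} → k ∉ D → (∀ p → p ∈preds gate k → Ready D p) →
          Schedule D → Schedule (k ∷ D)

  Ready-⊆ : ∀ {D E} → D ⊆ E → ∀ v → Ready D v → Ready E v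
  Ready-⊆ D⊆E (inj₁ _) _   = tt
  Ready-⊆ D⊆E (inj₂ _) k∈D = D⊆E k∈D

  Schedule⇒Unique : ∀ {D} → Schedule D → Unique D
  Schedule⇒Unique []            = []
  Schedule⇒Unique (add k∉D _ S) = ¬Any⇒All¬ _ k∉D ∷ Schedule⇒Unique S

  -- Starting from an arbitrary schedule and only enlarging it makes searches composable. The
  -- predicate `P` covers a single target as well as all predecessors of a gate.
  Extension : (Node n g → Set) → Set
  Extension P = ∀ {D} → Schedule D →
    ∃[ E ] Schedule E × D ⊆ E × (∀ v → P v → Ready E v)

  -- The search for `q` starts from the schedule found for `p`, so gates shared by both are listed
  -- once; readiness of `p` survives by monotonicity.
  extend-preds : (G : Gate (Node n g)) →
    (∀ p → p ∈preds G → Extension (p ≡_)) → Extension (_∈preds G)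
  extend-preds (¬-gate p) ext S =
    let E , S′ , D⊆E , r = ext p ¬-pred S
    in  E , S′ , D⊆E , λ { _ ¬-pred → r p refl }
  extend-preds (∨-gate p q) ext S =
    let E , S′ , D⊆E , r  = ext p ∨-predˡ S
        F , S″ , E⊆F , r′ = ext q ∨-predʳ S′
    in  F , S″ , E⊆F ∘ D⊆E , λ { _ ∨-predˡ → Ready-⊆ E⊆F p (r p refl) ; _ ∨-predʳ → r′ q refl }
  extend-preds (∧-gate p q) ext S =
    let E , S′ , D⊆E , r  = ext p ∧-predˡ S
        F , S″ , E⊆F , r′ = ext q ∧-predʳ S′
    in  F , S″ , E⊆F ∘ D⊆E , λ { _ ∧-predˡ → Ready-⊆ E⊆F p (r p refl) ; _ ∧-predʳ → r′ q refl }

  extend : ∀ v → Acc (Edge gate) v → Extension (v ≡_)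
  extend (inj₁ _) _        {D} S = D , S , id , λ { _ refl → tt }
  extend (inj₂ k) (acc rs) S
    with extend-preds (gate k) (λ p p∈ → extend p (rs (edge p∈))) S
  -- Membership is tested in the list `E` left by the predecessors, because `add` asks for freshness
  -- and readiness with respect to this list.
  ... | E , S′ , D⊆E , r with _∈?_ Fin._≟_ k E
  ...   | yes k∈E = E , S′ , D⊆E , λ { _ refl → k∈E }
  ...   | no  k∉E = k ∷ E , add k∉E r S′ , there ∘ D⊆E , λ { _ refl → here refl }

-- Code generation and its length.

reg : ∀ {n g} → Node n g → Focus
reg (inj₁ j) = inp (toℕ j)
reg (inj₂ k) = aux (toℕ k)

-- The instruction following the tests is executed if the gate has value T and
-- skipped otherwise.
tests : ∀ {n g} → Gate (Node n g) → List Instr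
tests (¬-gate p)   = -test (reg p ∙ get) ∷ []
tests (∨-gate p q) = -test (reg p ∙ get) ∷ +test (reg q ∙ get) ∷ []
tests (∧-gate p q) = -test (reg p ∙ get) ∷ # 3 ∷ +test (reg q ∙ get) ∷ []

setAux : ∀ {g} → Fin g → Basic
setAux k = aux (toℕ k) ∙ set true

-- The head of the schedule is evaluated last, so code is built from back to front, with `rest`
-- accumulating what follows.
schedCode : ∀ {n g} → (Fin g → Gate (Node n g)) → List (Fin g) → List Instr → List Instr
schedCode gate []      rest = rest
schedCode gate (k ∷ D) rest = schedCode gate D (tests (gate k) ++ plain (setAux k) ∷ rest)

outputCode : ∀ {n g} → Node n g → List Instr
outputCode v = +test (reg v ∙ get) ∷ plain (out ∙ set true) ∷ ! ∷ []

length-tests : ∀ {n g} (G : Gate (Node n g)) rest →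
  List.length (tests G ++ rest) ≤ 3 + List.length rest
length-tests G rest rewrite length-++ (tests G) {rest} =
  +-monoˡ-≤ (List.length rest) (bound G)
  where
  bound : ∀ {n g} (G : Gate (Node n g)) → List.length (tests G) ≤ 3
  bound (¬-gate _)   = +-monoʳ-≤ 1 z≤n
  bound (∨-gate _ _) = +-monoʳ-≤ 2 z≤n
  bound (∧-gate _ _) = +-monoʳ-≤ 3 z≤n

-- The factor 4 is at most three tests or jumps plus one `set` per gate.
length-schedCode : ∀ {n g} (gate : Fin g → Gate (Node n g)) D rest →
  List.length (schedCode gate D rest) ≤ 4 * List.length D + List.length rest
length-schedCode gate []      rest = ≤-refl
length-schedCode gate (k ∷ D) rest = begin
  List.length (schedCode gate D (tests (gate k) ++ plain (setAux k) ∷ rest))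
    ≤⟨ length-schedCode gate D _ ⟩
  4 * d + List.length (tests (gate k) ++ plain (setAux k) ∷ rest)
    ≤⟨ +-monoʳ-≤ (4 * d) (length-tests (gate k) _) ⟩
  4 * d + (4 + r)
    ≡⟨ +-assoc (4 * d) 4 r ⟨
  4 * d + 4 + r
    ≡⟨ cong (_+ r) (trans (+-comm (4 * d) 4) (sym (*-suc 4 d))) ⟩
  4 * suc d + r ∎
  where
  open ≤-Reasoning
  d = List.length D
  r = List.length rest

-- Permitted instructions and the absence of resets of `out`.

Admissible : Instr → Set
Admissible u = ∀ {a} → a OccursIn₁ u → Permitted a × a ≢ out ∙ set false

get-admissible : ∀ {n g} (v : Node n g) → Permitted (reg v ∙ get) × reg v ∙ get ≢ out ∙ set false
get-admissible (inj₁ _) = get-inp , λ ()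
get-admissible (inj₂ _) = get-aux , λ ()

tests-admissible : ∀ {n g} (G : Gate (Node n g)) → All Admissible (tests G)
tests-admissible (¬-gate p)   = (λ { in--test → get-admissible p }) ∷ []
tests-admissible (∨-gate p q) =
  (λ { in--test → get-admissible p }) ∷ (λ { in-+test → get-admissible q }) ∷ []
tests-admissible (∧-gate p q) =
  (λ { in--test → get-admissible p }) ∷ (λ ()) ∷ (λ { in-+test → get-admissible q }) ∷ []

schedCode-admissible : ∀ {n g} (gate : Fin g → Gate (Node n g)) D {rest} →
  All Admissible rest → All Admissible (schedCode gate D rest)
schedCode-admissible gate []      r = r
schedCode-admissible gate (k ∷ D) r = schedCode-admissible gate D
  (++⁺ (tests-admissible (gate k)) ((λ { in-plain → set-aux , λ () }) ∷ r))

outputCode-admissible : ∀ {n g} (v : Node n g) → All Admissible (outputCode v)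
outputCode-admissible v =
  (λ { in-+test → get-admissible v }) ∷ (λ { in-plain → set-out , λ () }) ∷ (λ ()) ∷ []

admissible⇒Permitted : ∀ X → All Admissible (toList X) → ISbr X × ¬ (out ∙ set false) OccursIn X
admissible⇒Permitted X ok =
  (λ _ a∈ → let f , o = lookupAny ok a∈ in proj₁ (f o)) ,
  (λ   a∈ → let f , o = lookupAny ok a∈ in proj₂ (f o) refl)

-- Execution of the remaining code.

get-within : ∀ {n g} (v : Node n g) → InputWithin n (reg v ∙ get)
get-within (inj₁ j) = Fin.toℕ<n j
get-within (inj₂ _) = tt

-- Translates the counter after a test into the code that remains. Plain instructions and jumps use
-- the case where `b` is `true`.
drop-if : ∀ {A : Set} (xs : List A) i {ys} → drop i xs ≡ ys → ∀ (b : Bool) k l →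
  drop (if b then k + i else l + i) xs ≡ (if b then drop k ys else drop l ys)
drop-if xs i refl true  k l =
  trans (cong (λ m → drop m xs) (+-comm k i)) (sym (drop-drop i k xs))
drop-if xs i refl false k l =
  trans (cong (λ m → drop m xs) (+-comm l i)) (sym (drop-drop i l xs))

-- Since jumps only go forward, the behaviour from a position depends only on the
-- instructions from there on.
module _ (n : ℕ) (r : Bool) where

  Halts : List Instr → State → Set
  Halts ys σ = ∀ X i → drop i (toList X) ≡ ys →
    ∃[ t ] ∃[ τ ] Run X i σ t τ × All (InputWithin n) t × τ out ≡ r

  halts-! : ∀ {ys σ} → σ out ≡ r → Halts (! ∷ ys) σ
  halts-! o X i at = _ , _ , run-! (cong head at) , [] , o

  halts-# : ∀ {ys σ} l → Halts (drop l ys) σ → Halts (# suc l ∷ ys) σ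
  halts-# {σ = σ} l h X i at =
    let t , τ , run , rest = h X (suc l + i) (drop-if (toList X) i at true (suc l) 0)
    in  t , τ , run-# (cong head at) (λ ())
                  -- The jump rule puts the offset to the right of the counter, the other rules to
                  -- the left.
                  (subst (λ j → Run X j σ t τ) (+-comm (suc l) i) run) , rest

  halts-plain : ∀ {a ys σ} → InputWithin n a → Halts ys (effect a σ) → Halts (plain a ∷ ys) σ
  halts-plain w h X i at =
    let _ , _ , run , ws , o = h X (1 + i) (drop-if (toList X) i at true 1 0)
    in  _ , _ , run-plain (cong head at) run , w ∷ ws , o

  halts-+test : ∀ {a ys σ} → InputWithin n a →
    Halts (if reply a σ then ys else drop 1 ys) (effect a σ) → Halts (+test a ∷ ys) σ
  halts-+test {a} {σ = σ} w h X i at =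
    let _ , _ , run , ws , o = h X _ (drop-if (toList X) i at (reply a σ) 1 2)
    in  _ , _ , run-+test (cong head at) run , w ∷ ws , o

  halts--test : ∀ {a ys σ} → InputWithin n a →
    Halts (if reply a σ then drop 1 ys else ys) (effect a σ) → Halts (-test a ∷ ys) σ
  halts--test {a} {σ = σ} w h X i at =
    let _ , _ , run , ws , o = h X _ (drop-if (toList X) i at (reply a σ) 2 1)
    in  _ , _ , run--test (cong head at) run , w ∷ ws , o

  -- Short-circuit evaluation: once the value of `p` is fixed, the condition reduces to a constant
  -- or to the value of `q`. Reading a register leaves the state unchanged.
  halts-tests : ∀ {g} (G : Gate (Node n g)) {u rest} σ →
    Halts (if gateValue G (λ p _ → σ (reg p)) then u ∷ rest else rest) σ →
    Halts (tests G ++ u ∷ rest) σ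
  halts-tests (¬-gate p) {u} {rest} σ h = halts--test (get-within p) (branch (σ (reg p)) h)
    where
    branch : ∀ c → Halts (if not c then u ∷ rest else rest) σ →
      Halts (if c then rest else u ∷ rest) σ
    branch true  h = h
    branch false h = h
  halts-tests (∨-gate p q) {u} {rest} σ h = halts--test (get-within p) (branch (σ (reg p)) h)
    where
    branch : ∀ c → Halts (if c ∨ σ (reg q) then u ∷ rest else rest) σ →
      Halts (if c then u ∷ rest else +test (reg q ∙ get) ∷ u ∷ rest) σ
    branch true  h = h
    branch false h = halts-+test (get-within q) h
  halts-tests (∧-gate p q) {u} {rest} σ h = halts--test (get-within p) (branch (σ (reg p)) h)
    where
    branch : ∀ c → Halts (if c ∧ σ (reg q) then u ∷ rest else rest) σ →
      Halts (if c then +test (reg q ∙ get) ∷ u ∷ rest else # 3 ∷ +test (reg q ∙ get) ∷ u ∷ rest) σ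
    branch true  h = halts-+test (get-within q) h
    -- A jump distance counts the jump itself, so `# 3` passes over two instructions: the second
    -- test and `u`.
    branch false h = halts-# 2 h

-- Register contents during execution.

effect-set-same : ∀ f c σ → effect (f ∙ set c) σ f ≡ c
effect-set-same f c σ rewrite dec-true (f ≟ f) refl = refl

effect-set-other : ∀ f c σ f′ → f′ ≢ f → effect (f ∙ set c) σ f′ ≡ σ f′
effect-set-other f c σ f′ f′≢f rewrite dec-false (f′ ≟ f) f′≢f = refl

module _ {n : ℕ} (C : Circuit n) (b : Vec Bool n) where
  open Circuit C

  record Invariant (D : List (Fin gates)) (σ : State) : Set where
    field
      input   : ∀ j → σ (inp (toℕ j)) ≡ lookup b j
      done    : ∀ {k} → k ∈ D → σ (aux (toℕ k)) ≡ value C b (inj₂ k)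
      pending : ∀ {k} → k ∉ D → σ (aux (toℕ k)) ≡ false
      output-pending : σ out ≡ false

  open Invariant

  initial⇒invariant : ∀ {σ} → Initial b σ → Invariant [] σ
  initial⇒invariant init = record
    { input          = Initial.inp-init init
    ; done           = λ ()
    ; pending        = λ _ → Initial.aux-init init _
    ; output-pending = Initial.out-init init
    }

  reg-value : ∀ {D σ} → Invariant D σ → ∀ v → Ready gate D v → σ (reg v) ≡ value C b v
  reg-value I (inj₁ j) _   = input I j
  reg-value I (inj₂ k) k∈D = done I k∈D

  -- Stated for any `σ′` differing from `σ` at most in the register of `k`, so that it serves both
  -- when the `set` is executed and when it is skipped.
  invariant-add : ∀ {D k σ σ′} → Invariant D σ →
    (∀ f → f ≢ aux (toℕ k) → σ′ f ≡ σ f) →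
    σ′ (aux (toℕ k)) ≡ value C b (inj₂ k) → Invariant (k ∷ D) σ′
  invariant-add {D} {k} {σ} {σ′} I same val = record
    { input          = λ j → trans (same _ λ ()) (input I j)
    ; done           = λ {l} → done′ l
    ; pending        = λ l∉ → trans (same _ (distinct λ { refl → l∉ (here refl) }))
                                    (pending I (l∉ ∘ there))
    ; output-pending = trans (same _ λ ()) (output-pending I)
    }
    where
    aux-injective : ∀ {i j} → aux i ≡ aux j → i ≡ j
    aux-injective refl = refl

    distinct : ∀ {l} → l ≢ k → aux (toℕ l) ≢ aux (toℕ k)
    distinct l≢k = l≢k ∘ Fin.toℕ-injective ∘ aux-injective

    done′ : ∀ l → l ∈ k ∷ D → σ′ (aux (toℕ l)) ≡ value C b (inj₂ l)
    done′ l l∈ with l Fin.≟ k | l∈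
    ... | yes refl | _         = val
    ... | no  l≢k  | here l≡k  = ⊥-elim (l≢k l≡k)
    ... | no  l≢k  | there l∈D = trans (same _ (distinct l≢k)) (done I l∈D)

  halts-gate : ∀ {r D k rest σ} → k ∉ D → (∀ p → p ∈preds gate k → Ready gate D p) →
    (∀ {σ} → Invariant (k ∷ D) σ → Halts n r rest σ) →
    Invariant D σ → Halts n r (tests (gate k) ++ plain (setAux k) ∷ rest) σ
  halts-gate {r} {D} {k} {rest} {σ} k∉D ready h I = halts-tests n r (gate k) σ
    -- The value read by the tests is replaced by the circuit value of `k`; `branch` then splits on
    -- it and keeps the equation.
    (subst (λ c → Halts n r (if c then _ else _) σ) (sym eq) (branch _ refl))
    where
    eq : gateValue (gate k) (λ p _ → σ (reg p)) ≡ value C b (inj₂ k)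
    eq = trans (gateValue-cong (gate k) λ p p∈ → reg-value I p (ready p p∈))
               (sym (value-gate C b k))

    branch : ∀ c → value C b (inj₂ k) ≡ c →
      Halts n r (if c then plain (setAux k) ∷ rest else rest) σ
    branch true  v = halts-plain n r tt (h (invariant-add I
      (effect-set-other _ _ σ) (trans (effect-set-same _ _ σ) (sym v))))
    -- With the `set` skipped, the register still holds its initial F, which is the value of the
    -- gate.
    branch false v = h (invariant-add I (λ _ _ → refl) (trans (pending I k∉D) (sym v)))

  -- The recursion follows the accumulator: each step absorbs the code of the last gate into `rest`
  -- and weakens the invariant required there from `k ∷ D` to `D`, down to the empty list.
  halts-schedCode : ∀ {r D rest} → Schedule gate D →
    (∀ {σ} → Invariant D σ → Halts n r rest σ) →
    ∀ {σ} → Invariant [] σ → Halts n r (schedCode gate D rest) σ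
  halts-schedCode []                  h = h
  halts-schedCode (add k∉D ready S) h = halts-schedCode S (halts-gate k∉D ready h)

  halts-outputCode : ∀ {D v σ} → Ready gate D v → Invariant D σ →
    Halts n (value C b v) (outputCode v) σ
  halts-outputCode {v = v} {σ} ready I =
    halts-+test n _ (get-within v) (branch _ (reg-value I v ready))
    where
    branch : ∀ c → c ≡ value C b v →
      Halts n (value C b v) (if c then plain (out ∙ set true) ∷ ! ∷ [] else ! ∷ []) σ
    branch true  eq = halts-plain n _ tt (halts-! n _ eq)
    branch false eq = halts-! n _ (trans (output-pending I) eq)

theorem5 : ∃[ c ] (∀ (n : ℕ) (C : Circuit n) →
    ∃[ X ] ISbr X × ¬ ((out ∙ set false) OccursIn X) × Computes X (induced C) × length X ≤ c * (size C + 1))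
-- Besides at most 4 instructions per gate there are 4 more, the leading jump and the three of
-- `outputCode`, whence 4 times the number of gates plus one.
theorem5 = 4 , λ n C →
  let open Circuit C
      D , S , _ , ready = extend gate output (edge-wellFounded C output) []
      -- The idle jump only makes the instruction sequence nonempty by construction.
      X = # 1 ∷ schedCode gate D (outputCode output)
      permitted , noReset = admissible⇒Permitted X
        ((λ ()) ∷ schedCode-admissible gate D (outputCode-admissible output))
  in  X , permitted , noReset ,
      (λ b σ init → halts-# n _ 0
        (halts-schedCode C b S (halts-outputCode C b (ready output refl)) (initial⇒invariant C b init))
        X 0 refl) ,
      (begin
        length X                  ≤⟨ +-monoʳ-≤ 1 (length-schedCode gate D _) ⟩
        1 + (4 * List.length D + 3) ≡⟨ cong suc (+-comm (4 * List.length D) 3) ⟩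
        4 + 4 * List.length D     ≡⟨ *-suc 4 (List.length D) ⟨
        4 * suc (List.length D)   ≤⟨ *-monoʳ-≤ 4 (+-monoʳ-≤ 1 (Unique⇒length≤ (Schedule⇒Unique gate S))) ⟩
        4 * suc gates             ≤⟨ *-monoʳ-≤ 4 (m≤n+m (suc gates) n) ⟩
        4 * (n + suc gates)       ≡⟨ cong (4 *_) (trans (cong (n +_) (+-comm 1 gates)) (sym (+-assoc n gates 1))) ⟩
        4 * (size C + 1)          ∎)
  where
  open ≤-Reasoning
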